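{- Let $n\ge 1$, let $a_1,a_2,\dots,a_n$ be distinct integers, and let $\mathcal{M}$ be a set of integers with $|\mathcal{M}|\le\left\lfloor\frac{n}{2}\right\rfloor$. Then there exists a permutation $(b_1,\dots,b_n)$ of the sequence $(a_1,\dots,a_n)$ such that none of the sums $b_1,\ b_1+b_2,\ \dots,\ b_1+b_2+\dots+b_{n-1}$ is an element of $\mathcal{M}$. Moreover, if the numbers $a_1,a_2,\dots,a_n$ are all nonzero, then the same conclusion holds under the weaker assumption $|\mathcal{M}|\le\left\lfloor\frac{n+1}{2}\right\rfloor$. -}

module Defs where

open import Data.Nat using (ℕ; zero; suc)
open import Data.Integer using (ℤ; _+_; 0ℤ)
open import Data.Fin using (Fin; zero; suc)

-- prefixSum b k = b 0 + b 1 + ... + b (k-1)   (for k ≤ n; saturates at n)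
prefixSum : ∀ {n} → (Fin n → ℤ) → ℕ → ℤ
prefixSum {zero}  b k       = 0ℤ
prefixSum {suc n} b zero    = 0ℤ
prefixSum {suc n} b (suc k) = b zero + prefixSum (λ i → b (suc i)) k

{-# OPTIONS --safe #-}
module Submission where

-- Write g(s) for the product of all s - m, m ∈ M, and sum the products g(b_1) g(b_1 + b_2) … over
-- all orderings b of n distinct integers, with the sign of the ordering. If this alternating sum is
-- nonzero, some ordering avoids M. Building the sum up one element at a time, it is a combination
-- of alternants det(x_i^(e_j)) with e_1 < e_2 < …: a new element puts an exponent 0 in front, and
-- multiplication by s - m, where s is the sum of the variables, raises one exponent at a time (an
-- alternant with two equal exponents vanishes), up to terms of lower degree. So the coefficients in
-- the top degree count such exponent paths. When the total degree is n(n-1)/2, only the exponents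
-- 0, …, n-1 can remain, hence the sum is the number of paths times a Vandermonde determinant, and
-- it suffices to exhibit one path. For n = 2k and |M| = k the degree is exactly (n-1)k = n(n-1)/2.
-- If the integers are nonzero and n is odd, adjoin the integer 0 and delete it from the ordering.
--
-- Instead of powers we use the Newton basis whose nodes are the given integers: multiplication by
-- s changes only by terms of lower degree, and the final determinant becomes triangular.

open import Defs
open import Data.Nat using (ℕ; _≤_; _<_; _/_; _∸_; zero; suc; z≤n; s≤s)
import Data.Nat as ℕ
open import Data.Nat.DivMod using (m*n/n≡m; m/n≡1+[m∸n]/n)
open import Data.Nat.ListAction using (sum)
open import Data.Nat.ListAction.Properties using (sum-++)
import Data.Nat.Properties as ℕ
import Data.Nat.Tactic.RingSolver as NatSolver
open import Data.Integer using (ℤ; 0ℤ; 1ℤ; _+_; _-_; _*_; -_) renaming (+_ to pos)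
import Data.Integer.Properties as ℤ
open import Data.Integer.Tactic.RingSolver using (solve-∀)
open import Data.Fin using (Fin; zero; suc; cast)
open import Data.Fin.Permutation using (Permutation′; _⟨$⟩ʳ_; id; cast-id; _∘ₚ_)
open import Data.Fin.Properties using (cast-involutive)
open import Data.List using (List; []; _∷_; _++_; length; map; foldr; take; drop; replicate; tabulate; lookup)
open import Data.List.Properties using (length-map; length-++; length-replicate; length-tabulate; lookup-tabulate; take++drop≡id; ++-identityʳ)
open import Data.List.Relation.Unary.All using (All; []; _∷_; universal) renaming (map to mapAll)
import Data.List.Relation.Unary.All.Properties as All
open import Data.List.Relation.Unary.AllPairs using ([]; _∷_)
open import Data.List.Relation.Unary.Any using (here; there)
open import Data.List.Relation.Unary.Unique.Propositional using (Unique)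
open import Data.List.Relation.Unary.Unique.Propositional.Properties using (tabulate⁺)
open import Data.List.Membership.Propositional using (_∈_; _∉_)
open import Data.List.Membership.Propositional.Properties using (∈-map⁺; ∈-++⁺ˡ; ∈-∃++)
open import Data.List.Relation.Binary.Subset.Propositional using (_⊆_)
open import Data.List.Relation.Binary.Permutation.Propositional using (_↭_; ↭-refl; ↭-trans; ↭-sym; prep; swap; ↭⇒↭ₛ)
open import Data.List.Relation.Binary.Permutation.Propositional.Properties using (↭-length; ∈-resp-↭; drop-mid)
open import Data.Product using (_×_; ∃; ∃₂; _,_)
open import Data.Sum using (_⊎_; inj₁; inj₂)
open import Function using (_∘_)
open import Function.Definitions using (Injective)
open import Relation.Nullary using (yes; no; contradiction)
open import Relation.Binary.PropositionalEquality using (_≡_; _≢_; refl; sym; trans; cong; cong₂; subst; setoid; module ≡-Reasoning)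
open import Data.List.Relation.Binary.Permutation.Setoid (setoid ℤ) using (onIndices)
open import Data.List.Relation.Binary.Permutation.Setoid.Properties (setoid ℤ) using (onIndices-lookup; foldr-commMonoid)

sumℤ : List ℤ → ℤ
sumℤ = foldr _+_ 0ℤ

sumℤ-↭ : ∀ {xs ys} → xs ↭ ys → sumℤ xs ≡ sumℤ ys
sumℤ-↭ p = foldr-commMonoid ℤ.+-0-isCommutativeMonoid (↭⇒↭ₛ p)

-- Alternating sums

-- The pattern of Laplace expansion: the accumulated minus signs give the element in position i the
-- sign (-1)^i, and the remaining elements keep their order.
altSum : (ℤ → List ℤ → ℤ) → List ℤ → ℤ
altSum F [] = 0ℤ
altSum F (x ∷ xs) = F x xs - altSum (λ y ys → F y (x ∷ ys)) xs

-- The premise `y ∷ ys ↭ xs` is what lets `pieri` replace the sum of all variables by `y + sumℤ ys`.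
altSum-cong : ∀ {F G} xs → (∀ y ys → y ∷ ys ↭ xs → F y ys ≡ G y ys) → altSum F xs ≡ altSum G xs
altSum-cong [] F≗G = refl
altSum-cong (x ∷ xs) F≗G = cong₂ _-_ (F≗G x xs ↭-refl)
  (altSum-cong xs λ y ys p → F≗G y (x ∷ ys) (↭-trans (swap y x ↭-refl) (prep x p)))

altSum-+ : ∀ F G xs → altSum (λ y ys → F y ys + G y ys) xs ≡ altSum F xs + altSum G xs
altSum-+ F G [] = refl
altSum-+ F G (x ∷ xs) = trans
  (cong (λ s → F x xs + G x xs - s) (altSum-+ F′ G′ xs))
  (regroup (F x xs) (G x xs) (altSum F′ xs) (altSum G′ xs))
  where
  F′ G′ : ℤ → List ℤ → ℤ
  F′ y ys = F y (x ∷ ys)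
  G′ y ys = G y (x ∷ ys)
  regroup : ∀ p q r s → p + q - (r + s) ≡ (p - r) + (q - s)
  regroup = solve-∀

altSum-* : ∀ z F xs → altSum (λ y ys → z * F y ys) xs ≡ z * altSum F xs
altSum-* z F [] = sym (ℤ.*-zeroʳ z)
altSum-* z F (x ∷ xs) = trans
  (cong (λ s → z * F x xs - s) (altSum-* z F′ xs))
  (factor z (F x xs) (altSum F′ xs))
  where
  F′ : ℤ → List ℤ → ℤ
  F′ y ys = F y (x ∷ ys)
  factor : ∀ z p q → z * p - z * q ≡ z * (p - q)
  factor = solve-∀

altSum-zero : ∀ xs → altSum (λ _ _ → 0ℤ) xs ≡ 0ℤ
altSum-zero [] = refl
altSum-zero (x ∷ xs) = cong (λ s → 0ℤ - s) (altSum-zero xs)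

altSum-vanish : ∀ {F} xs → (∀ y ys → F y ys ≡ 0ℤ) → altSum F xs ≡ 0ℤ
altSum-vanish xs F≗0 = trans (altSum-cong xs λ y ys _ → F≗0 y ys) (altSum-zero xs)

-- Taking out two elements in the two possible orders gives opposite signs. The terms with the head
-- `x` first cancel those with `x` second, and induction covers the pairs without `x`.
altSum-symmetric : ∀ (H : ℤ → ℤ → List ℤ → ℤ) → (∀ x y zs → H x y zs ≡ H y x zs) →
                   ∀ xs → altSum (λ x → altSum (H x)) xs ≡ 0ℤ
altSum-symmetric H H-sym [] = refl
altSum-symmetric H H-sym (x ∷ xs) = begin
  altSum (H x) xs - altSum (λ y ys → H y x ys - inner y ys) xs
    ≡⟨ cong (λ s → altSum (H x) xs - s) split ⟩
  altSum (H x) xs - (altSum (H x) xs + - 1ℤ * altSum inner xs)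
    ≡⟨ cong (λ s → altSum (H x) xs - (altSum (H x) xs + - 1ℤ * s))
            (altSum-symmetric (λ y z zs → H y z (x ∷ zs)) (λ y z zs → H-sym y z (x ∷ zs)) xs) ⟩
  altSum (H x) xs - (altSum (H x) xs + - 1ℤ * 0ℤ)
    ≡⟨ cancel (altSum (H x) xs) ⟩
  0ℤ ∎
  where
  open ≡-Reasoning
  inner : ℤ → List ℤ → ℤ
  inner y = altSum (λ z zs → H y z (x ∷ zs))
  negate : ∀ p q → p - q ≡ p + - 1ℤ * q
  negate = solve-∀
  cancel : ∀ p → p - (p + - 1ℤ * 0ℤ) ≡ 0ℤ
  cancel = solve-∀
  split : altSum (λ y ys → H y x ys - inner y ys) xs ≡ altSum (H x) xs + - 1ℤ * altSum inner xs
  split = begin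
    altSum (λ y ys → H y x ys - inner y ys) xs
      ≡⟨ altSum-cong xs (λ y ys _ → trans (cong (_- inner y ys) (H-sym y x ys)) (negate (H x y ys) (inner y ys))) ⟩
    altSum (λ y ys → H x y ys + - 1ℤ * inner y ys) xs
      ≡⟨ altSum-+ _ _ xs ⟩
    altSum (H x) xs + altSum (λ y ys → - 1ℤ * inner y ys) xs
      ≡⟨ cong (altSum (H x) xs +_) (altSum-* (- 1ℤ) inner xs) ⟩
    altSum (H x) xs + - 1ℤ * altSum inner xs ∎

altSum-nonzero : ∀ F xs → altSum F xs ≢ 0ℤ → ∃₂ λ y ys → y ∷ ys ↭ xs × F y ys ≢ 0ℤ
altSum-nonzero F [] s≢0 = contradiction refl s≢0
altSum-nonzero F (x ∷ xs) s≢0 with F x xs ℤ.≟ 0ℤ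
... | no Fx≢0 = x , xs , ↭-refl , Fx≢0
... | yes Fx≡0
  with y , ys , p , Fy≢0 ← altSum-nonzero (λ y ys → F y (x ∷ ys)) xs
         (λ s≡0 → s≢0 (cong₂ _-_ Fx≡0 s≡0))
  = y , x ∷ ys , ↭-trans (swap y x ↭-refl) (prep x p) , Fy≢0

-- Exponent sequences

data Inc : ℕ → List ℕ → Set where
  []  : ∀ {b} → Inc b []
  _∷_ : ∀ {b e es} → b ≤ e → Inc (suc e) es → Inc b (e ∷ es)

Inc-weaken : ∀ {b b′ es} → b ≤ b′ → Inc b′ es → Inc b es
Inc-weaken b≤b′ [] = []
Inc-weaken b≤b′ (b′≤e ∷ inc) = ℕ.≤-trans b≤b′ b′≤e ∷ inc

iota : ℕ → ℕ → List ℕ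
iota b zero = []
iota b (suc ℓ) = b ∷ iota (suc b) ℓ

Inc-iota++ : ∀ b ℓ {H} → Inc (b ℕ.+ ℓ) H → Inc b (iota b ℓ ++ H)
Inc-iota++ b zero inc = subst (λ n → Inc n _) (ℕ.+-identityʳ b) inc
Inc-iota++ b (suc ℓ) {H} inc = ℕ.≤-refl ∷ Inc-iota++ (suc b) ℓ (subst (λ n → Inc n H) (ℕ.+-suc b ℓ) inc)

sum-iota-≤ : ∀ {b es} → Inc b es → sum (iota b (length es)) ≤ sum es
sum-iota-≤ [] = z≤n
sum-iota-≤ (b≤e ∷ inc) = ℕ.+-mono-≤ b≤e (sum-iota-≤ (Inc-weaken (s≤s b≤e) inc))

-- The tail already has at least its minimal sum, so the bound on the total leaves no room for the
-- head to exceed `b`.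
Inc-minimal : ∀ {b es} → Inc b es → sum es ≤ sum (iota b (length es)) → es ≡ iota b (length es)
Inc-minimal [] _ = refl
Inc-minimal {b} {e ∷ es} (b≤e ∷ inc) total≤ = step (ℕ.≤-antisym e≤b b≤e)
  where
  low : sum (iota (suc b) (length es)) ≤ sum es
  low = sum-iota-≤ (Inc-weaken (s≤s b≤e) inc)
  e≤b : e ≤ b
  e≤b = ℕ.+-cancelʳ-≤ (sum es) e b (ℕ.≤-trans total≤ (ℕ.+-monoʳ-≤ b low))
  step : e ≡ b → e ∷ es ≡ iota b (suc (length es))
  step refl = cong (e ∷_) (Inc-minimal inc (ℕ.+-cancelˡ-≤ e _ _ total≤))

increments : List ℕ → List (List ℕ)
increments [] = []
increments (e ∷ es) = (suc e ∷ es) ∷ map (e ∷_) (increments es)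

-- The conditions concern the target only, so a `Step` by itself certifies that its target increases
-- strictly.
data Step (b : ℕ) : List ℕ → List ℕ → Set where
  bump : ∀ {e es} → b ≤ suc e → Inc (suc (suc e)) es → Step b (e ∷ es) (suc e ∷ es)
  keep : ∀ {e es es′} → b ≤ e → Step (suc e) es es′ → Step b (e ∷ es) (e ∷ es′)

Step⇒∈ : ∀ {b es es′} → Step b es es′ → es′ ∈ increments es
Step⇒∈ (bump _ _) = here refl
Step⇒∈ (keep _ s) = there (∈-map⁺ _ (Step⇒∈ s))

Step⇒Inc : ∀ {b es es′} → Step b es es′ → Inc b es′
Step⇒Inc (bump b≤e inc) = b≤e ∷ inc
Step⇒Inc (keep b≤e s) = b≤e ∷ Step⇒Inc s

Step-length : ∀ {b es es′} → Step b es es′ → length es′ ≡ length es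
Step-length (bump _ _) = refl
Step-length (keep _ s) = cong suc (Step-length s)

Step-sum : ∀ {b es es′} → Step b es es′ → sum es′ ≡ suc (sum es)
Step-sum (bump _ _) = refl
Step-sum (keep {e} _ s) = trans (cong (e ℕ.+_) (Step-sum s)) (ℕ.+-suc e _)

data Steps (b : ℕ) : ℕ → List ℕ → List ℕ → Set where
  done : ∀ {es} → Steps b 0 es es
  _▸_  : ∀ {d es es′ es″} → Steps b d es es′ → Step b es′ es″ → Steps b (suc d) es es″

-- The degrees are listed with the latest round first. A path to es witnesses that the alternant
-- of es occurs with a positive coefficient in the expansion of orderSum.
data Path : List ℕ → List ℕ → Set where
  start : Path [] []
  round : ∀ {d ds es es′} → Path ds es → Inc 1 es → Steps 0 d (0 ∷ es) es′ → Path (d ∷ ds) es′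

-- Alternants

module Alternant (c : ℕ → ℤ) where

  newton : ℕ → ℤ → ℤ
  newton zero x = 1ℤ
  newton (suc e) x = (x - c e) * newton e x

  -- The determinant of the matrix of all `newton e x`, expanded along the line of the first
  -- exponent; it is 0 when the two lists differ in length.
  alt : List ℕ → List ℤ → ℤ
  alt [] [] = 1ℤ
  alt [] (_ ∷ _) = 0ℤ
  alt (e ∷ es) = altSum (λ x ys → newton e x * alt es ys)

  alt-repeat : ∀ e es xs → alt (e ∷ e ∷ es) xs ≡ 0ℤ
  alt-repeat e es xs = trans
    (altSum-cong xs λ x ys _ → sym (altSum-* (newton e x) _ ys))
    (altSum-symmetric (λ x y zs → newton e x * (newton e y * alt es zs))
                      (λ x y zs → exchange (newton e x) (newton e y) (alt es zs)) xs)
    where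
    exchange : ∀ p q r → p * (q * r) ≡ q * (p * r)
    exchange = solve-∀

  alt-cons-zero : ∀ e es → (∀ ys → alt es ys ≡ 0ℤ) → ∀ xs → alt (e ∷ es) xs ≡ 0ℤ
  alt-cons-zero e es es≗0 xs = altSum-vanish xs λ y ys → trans (cong (newton e y *_) (es≗0 ys)) (ℤ.*-zeroʳ (newton e y))

  sumAlt : List (List ℕ) → List ℤ → ℤ
  sumAlt [] xs = 0ℤ
  sumAlt (es ∷ ess) xs = alt es xs + sumAlt ess xs

  sumAlt-cons : ∀ e ess xs → altSum (λ x ys → newton e x * sumAlt ess ys) xs ≡ sumAlt (map (e ∷_) ess) xs
  sumAlt-cons e [] xs = altSum-vanish xs λ y ys → ℤ.*-zeroʳ (newton e y)
  sumAlt-cons e (es ∷ ess) xs = begin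
    altSum (λ x ys → newton e x * (alt es ys + sumAlt ess ys)) xs
      ≡⟨ altSum-cong xs (λ x ys _ → ℤ.*-distribˡ-+ (newton e x) _ _) ⟩
    altSum (λ x ys → newton e x * alt es ys + newton e x * sumAlt ess ys) xs
      ≡⟨ altSum-+ _ _ xs ⟩
    alt (e ∷ es) xs + altSum (λ x ys → newton e x * sumAlt ess ys) xs
      ≡⟨ cong (alt (e ∷ es) xs +_) (sumAlt-cons e ess xs) ⟩
    alt (e ∷ es) xs + sumAlt (map (e ∷_) ess) xs ∎
    where open ≡-Reasoning

  weight : List ℕ → ℤ
  weight es = sumℤ (map c es)

  -- Multiplication by x acts on the Newton basis by x · newton e x = newton (e + 1) x + c e · newton e x.
  pieri : ∀ es xs → sumℤ xs * alt es xs ≡ sumAlt (increments es) xs + weight es * alt es xs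
  pieri [] [] = refl
  pieri [] (x ∷ xs) = ℤ.*-zeroʳ (sumℤ (x ∷ xs))
  pieri (e ∷ es) xs = begin
    sumℤ xs * alt (e ∷ es) xs
      ≡⟨ altSum-* (sumℤ xs) _ xs ⟨
    altSum (λ x ys → sumℤ xs * (newton e x * alt es ys)) xs
      ≡⟨ altSum-cong xs pointwise ⟩
    altSum (λ x ys → newton (suc e) x * alt es ys +
                     (newton e x * sumAlt (increments es) ys +
                      (c e + weight es) * (newton e x * alt es ys))) xs
      ≡⟨ trans (altSum-+ _ _ xs) (cong (alt (suc e ∷ es) xs +_) (altSum-+ _ _ xs)) ⟩
    alt (suc e ∷ es) xs + (altSum (λ x ys → newton e x * sumAlt (increments es) ys) xs +
      altSum (λ x ys → (c e + weight es) * (newton e x * alt es ys)) xs)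
      ≡⟨ cong₂ (λ s t → alt (suc e ∷ es) xs + (s + t)) (sumAlt-cons e (increments es) xs)
              (altSum-* (c e + weight es) (λ x ys → newton e x * alt es ys) xs) ⟩
    alt (suc e ∷ es) xs + (sumAlt (map (e ∷_) (increments es)) xs + (c e + weight es) * alt (e ∷ es) xs)
      ≡⟨ ℤ.+-assoc (alt (suc e ∷ es) xs) _ _ ⟨
    sumAlt (increments (e ∷ es)) xs + weight (e ∷ es) * alt (e ∷ es) xs ∎
    where
    open ≡-Reasoning
    expand : ∀ x s p a → (x + s) * (p * a) ≡ x * p * a + p * (s * a)
    expand = solve-∀
    collect : ∀ x ce p a i w → x * p * a + p * (i + w * a) ≡ (x - ce) * p * a + (p * i + (ce + w) * (p * a))
    collect = solve-∀
    -- The sum of the variables is split as `x + sumℤ ys`: the factor `x` raises `e`, and `sumℤ ys`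
    -- is absorbed by the induction hypothesis.
    pointwise : ∀ x ys → x ∷ ys ↭ xs →
      sumℤ xs * (newton e x * alt es ys) ≡
      newton (suc e) x * alt es ys + (newton e x * sumAlt (increments es) ys + (c e + weight es) * (newton e x * alt es ys))
    pointwise x ys p = begin
      sumℤ xs * (newton e x * alt es ys)
        ≡⟨ cong (_* (newton e x * alt es ys)) (sumℤ-↭ p) ⟨
      (x + sumℤ ys) * (newton e x * alt es ys)
        ≡⟨ expand x (sumℤ ys) (newton e x) (alt es ys) ⟩
      x * newton e x * alt es ys + newton e x * (sumℤ ys * alt es ys)
        ≡⟨ cong (λ s → x * newton e x * alt es ys + newton e x * s) (pieri es ys) ⟩
      x * newton e x * alt es ys + newton e x * (sumAlt (increments es) ys + weight es * alt es ys)
        ≡⟨ collect x (c e) (newton e x) (alt es ys) _ _ ⟩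
      newton (suc e) x * alt es ys + (newton e x * sumAlt (increments es) ys + (c e + weight es) * (newton e x * alt es ys)) ∎

  -- Nonvanishing of the final determinant

  newton-root : ∀ {i e} → i < e → newton e (c i) ≡ 0ℤ
  newton-root {i} {suc e} (s≤s i≤e) with ℕ.m≤n⇒m<n∨m≡n i≤e
  ... | inj₁ i<e = trans (cong ((c i - c e) *_) (newton-root i<e)) (ℤ.*-zeroʳ (c i - c e))
  ... | inj₂ refl = trans (cong (_* newton e (c e)) (ℤ.+-inverseʳ (c e))) (ℤ.*-zeroˡ (newton e (c e)))

  newton-nonzero : ∀ e x → (∀ i → i < e → c i ≢ x) → newton e x ≢ 0ℤ
  newton-nonzero zero x _ ()
  newton-nonzero (suc e) x c≢x eq with ℤ.i*j≡0⇒i≡0∨j≡0 (x - c e) eq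
  ... | inj₁ eq₁ = c≢x e ℕ.≤-refl (sym (ℤ.i-j≡0⇒i≡j x (c e) eq₁))
  ... | inj₂ eq₂ = newton-nonzero e x (λ i i<e → c≢x i (ℕ.m<n⇒m<1+n i<e)) eq₂

  alt-row-zero : ∀ {x es} → All (λ e → newton e x ≡ 0ℤ) es → ∀ ys → alt es (x ∷ ys) ≡ 0ℤ
  alt-row-zero [] ys = refl
  alt-row-zero {x} {e ∷ es} (e≡0 ∷ es≡0) ys = cong₂ _-_
    (trans (cong (_* alt es ys) e≡0) (ℤ.*-zeroˡ (alt es ys)))
    (altSum-vanish ys λ y zs → trans (cong (newton e y *_) (alt-row-zero es≡0 zs)) (ℤ.*-zeroʳ (newton e y)))

  -- The matrix (newton e (c i)) is triangular.
  alt-iota-nonzero : ∀ b ℓ → (∀ i j → i < j → j < b ℕ.+ ℓ → c i ≢ c j) →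
                     alt (iota b ℓ) (map c (iota b ℓ)) ≢ 0ℤ
  alt-iota-nonzero b zero _ ()
  alt-iota-nonzero b (suc ℓ) inj eq
    with ℤ.i*j≡0⇒i≡0∨j≡0 (newton b (c b)) (trans (sym first-column) eq)
    where
    roots : ∀ b′ ℓ → b < b′ → All (λ e → newton e (c b) ≡ 0ℤ) (iota b′ ℓ)
    roots b′ zero b<b′ = []
    roots b′ (suc ℓ) b<b′ = newton-root b<b′ ∷ roots (suc b′) ℓ (ℕ.m<n⇒m<1+n b<b′)
    -- Every other term of the expansion leaves `c b` among the variables, and `c b` is a root of
    -- all the remaining Newton polynomials.
    first-column : alt (iota b (suc ℓ)) (map c (iota b (suc ℓ))) ≡
                   newton b (c b) * alt (iota (suc b) ℓ) (map c (iota (suc b) ℓ))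
    first-column = trans
      (cong (λ s → newton b (c b) * alt (iota (suc b) ℓ) (map c (iota (suc b) ℓ)) - s)
        (altSum-vanish (map c (iota (suc b) ℓ)) λ y zs →
          trans (cong (newton b y *_) (alt-row-zero (roots (suc b) ℓ ℕ.≤-refl) zs)) (ℤ.*-zeroʳ (newton b y))))
      (ℤ.+-identityʳ _)
  ... | inj₁ eq₁ = newton-nonzero b (c b)
                     (λ i i<b → inj i b i<b (ℕ.m<m+n b (s≤s z≤n))) eq₁
  ... | inj₂ eq₂ = alt-iota-nonzero (suc b) ℓ
                     (λ i j i<j j<n → inj i j i<j (subst (j <_) (sym (ℕ.+-suc b ℓ)) j<n)) eq₂

  -- Combinations of alternants of bounded degree

  -- Coefficients below degree `N` involve the nodes and the roots, so their signs are not
  -- controlled. Those in degree `N` are natural numbers, so no cancellation can occur there.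
  data Admissible (N : ℕ) (es : List ℕ) : ℤ → Set where
    below : ∀ {z} → sum es < N → Admissible N es z
    level : ∀ t → sum es ≡ N → Admissible N es (pos t)

  Admissible-suc : ∀ {N es es′ z} → sum es′ ≡ suc (sum es) → Admissible N es z → Admissible (suc N) es′ z
  Admissible-suc eq (below es<N) = below (subst (_< _) (sym eq) (s≤s es<N))
  Admissible-suc eq (level t es≡N) = level t (trans eq (cong suc es≡N))

  Admissible⇒< : ∀ {N es z} → Admissible N es z → sum es < suc N
  Admissible⇒< (below es<N) = ℕ.m<n⇒m<1+n es<N
  Admissible⇒< (level _ refl) = ℕ.≤-refl

  -- Positivity is required of the coefficients in the top degree N only.
  data Span (N ℓ : ℕ) : (List ℤ → ℤ) → Set where
    zeroˢ : Span N ℓ (λ _ → 0ℤ)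
    term  : ∀ z {es} → Inc 0 es → length es ≡ ℓ → Admissible N es z → Span N ℓ (λ xs → z * alt es xs)
    plus  : ∀ {f g} → Span N ℓ f → Span N ℓ g → Span N ℓ (λ xs → f xs + g xs)
    ext   : ∀ {f g} → Span N ℓ f → (∀ xs → f xs ≡ g xs) → Span N ℓ g

  IncOrZero : ℕ → List ℕ → Set
  IncOrZero b es = Inc b es ⊎ (∀ xs → alt es xs ≡ 0ℤ)

  record Increment (b : ℕ) (es es′ : List ℕ) : Set where
    constructor increment
    field
      incOrZero : IncOrZero b es′
      len       : length es′ ≡ length es
      total     : sum es′ ≡ suc (sum es)

  -- Raising an entry by one can only fail by a collision with the next entry, and then `alt-repeat`
  -- applies.
  increments-spec : ∀ {b es} → Inc b es → All (Increment b es) (increments es)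
  increments-spec [] = []
  increments-spec {b} {e ∷ es} (b≤e ∷ inc) =
    increment (bumped inc) refl refl ∷ All.map⁺ (mapAll cons (increments-spec inc))
    where
    bumped : ∀ {es} → Inc (suc e) es → IncOrZero b (suc e ∷ es)
    bumped [] = inj₁ (ℕ.m≤n⇒m≤1+n b≤e ∷ [])
    bumped {f ∷ fs} (e<f ∷ incf) with ℕ.m≤n⇒m<n∨m≡n e<f
    ... | inj₁ 1+e<f = inj₁ (ℕ.m≤n⇒m≤1+n b≤e ∷ 1+e<f ∷ incf)
    ... | inj₂ refl = inj₂ (alt-repeat (suc e) fs)
    cons : ∀ {es′} → Increment (suc e) es es′ → Increment b (e ∷ es) (e ∷ es′)
    cons (increment (inj₁ inc′) len total) = increment
      (inj₁ (b≤e ∷ inc′)) (cong suc len) (trans (cong (e ℕ.+_) total) (ℕ.+-suc e (sum es)))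
    cons {es′} (increment (inj₂ zero′) len total) = increment
      (inj₂ (alt-cons-zero e es′ zero′)) (cong suc len) (trans (cong (e ℕ.+_) total) (ℕ.+-suc e (sum es)))

  scaled : ∀ {N es es′} z → Increment 0 es es′ → Admissible N es z →
           Span (suc N) (length es) (λ xs → z * alt es′ xs)
  scaled z (increment (inj₁ inc) len total) adm = term z inc len (Admissible-suc total adm)
  scaled z (increment (inj₂ es≗0) _ _) adm = ext zeroˢ λ xs → sym (trans (cong (z *_) (es≗0 xs)) (ℤ.*-zeroʳ z))

  Span-sumAlt : ∀ {N es ess} z → All (Increment 0 es) ess → Admissible N es z →
                Span (suc N) (length es) (λ xs → z * sumAlt ess xs)
  Span-sumAlt z [] adm = ext zeroˢ λ xs → sym (ℤ.*-zeroʳ z)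
  Span-sumAlt {ess = es′ ∷ ess} z (i ∷ is) adm = ext (plus (scaled z i adm) (Span-sumAlt z is adm))
    λ xs → sym (ℤ.*-distribˡ-+ z (alt es′ xs) (sumAlt ess xs))

  -- By `pieri` the raised alternants inherit the coefficient `z`. The correction `weight es - m`
  -- multiplies the old alternant, whose degree is below the new top degree, so its sign is
  -- harmless.
  Span-mul : ∀ {N ℓ f} m → Span N ℓ f → Span (suc N) ℓ (λ xs → (sumℤ xs - m) * f xs)
  Span-mul m zeroˢ = ext zeroˢ λ xs → sym (ℤ.*-zeroʳ (sumℤ xs - m))
  Span-mul m (term z {es} inc refl adm) = ext
    (plus (Span-sumAlt z (increments-spec inc) adm)
          (term (z * (weight es - m)) inc refl (below (Admissible⇒< adm))))
    λ xs → sym (trans (open-up (sumℤ xs) m z (alt es xs))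
                (trans (cong (λ s → z * (s - m * alt es xs)) (pieri es xs))
                       (regroup z (sumAlt (increments es) xs) (weight es) (alt es xs) m)))
    where
    open-up : ∀ s m z a → (s - m) * (z * a) ≡ z * (s * a - m * a)
    open-up = solve-∀
    regroup : ∀ z i w a m → z * (i + w * a - m * a) ≡ z * i + z * (w - m) * a
    regroup = solve-∀
  Span-mul m (plus {f} {g} p q) = ext (plus (Span-mul m p) (Span-mul m q))
    λ xs → sym (ℤ.*-distribˡ-+ (sumℤ xs - m) (f xs) (g xs))
  Span-mul m (ext p f≗g) = ext (Span-mul m p) λ xs → cong ((sumℤ xs - m) *_) (f≗g xs)

  alt-prepend : ∀ es xs → altSum (λ _ → alt es) xs ≡ alt (0 ∷ es) xs
  alt-prepend es xs = altSum-cong xs λ y ys _ → sym (ℤ.*-identityˡ (alt es ys))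

  -- A new exponent 0 either meets a leading 0, so that the alternant vanishes, or keeps the
  -- sequence strictly increasing; the degree does not change.
  Span-prepend : ∀ {N ℓ f} → Span N ℓ f → Span N (suc ℓ) (altSum (λ _ → f))
  Span-prepend zeroˢ = ext zeroˢ λ xs → sym (altSum-zero xs)
  Span-prepend {N} {ℓ} (term z {es} inc len adm) = ext (prepended inc len adm)
    λ xs → sym (trans (altSum-* z (λ _ → alt es) xs) (cong (z *_) (alt-prepend es xs)))
    where
    cons₀ : ∀ {es} → Admissible N es z → Admissible N (0 ∷ es) z
    cons₀ (below es<N) = below es<N
    cons₀ (level t es≡N) = level t es≡N
    prepended : ∀ {es} → Inc 0 es → length es ≡ ℓ → Admissible N es z →
                Span N (suc ℓ) (λ xs → z * alt (0 ∷ es) xs)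
    prepended [] len adm = term z (z≤n ∷ []) (cong suc len) (cons₀ adm)
    prepended {zero ∷ es} (_ ∷ inc) len adm = ext zeroˢ
      λ xs → sym (trans (cong (z *_) (alt-repeat 0 es xs)) (ℤ.*-zeroʳ z))
    prepended {suc e ∷ es} (_ ∷ inc) len adm = term z (z≤n ∷ s≤s z≤n ∷ inc) (cong suc len) (cons₀ adm)
  Span-prepend (plus {f} {g} p q) = ext (plus (Span-prepend p) (Span-prepend q))
    λ xs → sym (altSum-+ (λ _ → f) (λ _ → g) xs)
  Span-prepend (ext p f≗g) = ext (Span-prepend p) λ xs → altSum-cong xs λ _ ys _ → f≗g ys

  -- iota 0 n is the only strictly increasing sequence of its length and degree at most its degree.
  Span-minimal : ∀ {n f} → Span (sum (iota 0 n)) n f → ∃ λ t → ∀ xs → f xs ≡ pos t * alt (iota 0 n) xs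
  Span-minimal {n} zeroˢ = 0 , λ xs → sym (ℤ.*-zeroˡ (alt (iota 0 n) xs))
  Span-minimal (term z {es} inc refl (below es<)) = contradiction es< (ℕ.≤⇒≯ (sum-iota-≤ inc))
  Span-minimal (term z {es} inc refl (level t total)) =
    t , λ xs → cong (λ es′ → pos t * alt es′ xs) (Inc-minimal inc (ℕ.≤-reflexive total))
  Span-minimal {n} (plus p q) with t , f≗ ← Span-minimal p | u , g≗ ← Span-minimal q =
    t ℕ.+ u , λ xs → trans (cong₂ _+_ (f≗ xs) (g≗ xs)) (sym (ℤ.*-distribʳ-+ (alt (iota 0 n) xs) (pos t) (pos u)))
  Span-minimal (ext p f≗g) with t , f≗ ← Span-minimal p = t , λ xs → trans (sym (f≗g xs)) (f≗ xs)

  -- Following one leading alternant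

  -- One copy of the alternant of `es` is set aside. Further copies in `rest` have nonnegative
  -- coefficients and cannot cancel it.
  record Leads (N ℓ : ℕ) (es : List ℕ) (f : List ℤ → ℤ) : Set where
    constructor leads
    field
      increasing : Inc 0 es
      len        : length es ≡ ℓ
      total      : sum es ≡ N
      {rest}     : List ℤ → ℤ
      spans      : Span N ℓ rest
      splits     : ∀ xs → f xs ≡ alt es xs + rest xs

  ∈-split : ∀ {N es es′ ess} → sum es ≡ N → All (Increment 0 es) ess → es′ ∈ ess →
            ∃ λ r → Span (suc N) (length es) r × (∀ xs → sumAlt ess xs ≡ alt es′ xs + r xs)
  ∈-split {ess = es₁ ∷ ess} total (i ∷ is) (here refl) =
    _ , Span-sumAlt 1ℤ is (level 1 total) ,
    λ xs → cong (alt es₁ xs +_) (sym (ℤ.*-identityˡ (sumAlt ess xs)))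
  ∈-split {es′ = es′} {ess = es₁ ∷ ess} total (i ∷ is) (there es′∈)
    with r , span , eq ← ∈-split total is es′∈ =
    _ , plus (scaled 1ℤ i (level 1 total)) span ,
    λ xs → trans (cong (alt es₁ xs +_) (eq xs)) (rotate (alt es₁ xs) (alt es′ xs) (r xs))
    where
    rotate : ∀ p q r → p + (q + r) ≡ q + (1ℤ * p + r)
    rotate = solve-∀

  Leads-mul : ∀ {N ℓ es es′ f} m → Step 0 es es′ → Leads N ℓ es f →
              Leads (suc N) ℓ es′ (λ xs → (sumℤ xs - m) * f xs)
  Leads-mul {es = es} {es′} m step (leads inc refl total {rest} spans splits)
    with r , span , eq ← ∈-split total (increments-spec inc) (Step⇒∈ step) =
    leads (Step⇒Inc step) (Step-length step) (trans (Step-sum step) (cong suc total))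
      (plus span (plus (term (weight es - m) inc refl (below (s≤s (ℕ.≤-reflexive total))))
                       (Span-mul m spans)))
      λ xs → trans (cong ((sumℤ xs - m) *_) (splits xs))
        (trans (open-up (sumℤ xs) m (alt es xs) (rest xs))
        (trans (cong (λ s → s - m * alt es xs + (sumℤ xs - m) * rest xs)
                     (trans (pieri es xs) (cong (_+ weight es * alt es xs) (eq xs))))
               (regroup (alt es′ xs) (r xs) (weight es) (alt es xs) m ((sumℤ xs - m) * rest xs))))
    where
    open-up : ∀ s m a r → (s - m) * (a + r) ≡ s * a - m * a + (s - m) * r
    open-up = solve-∀
    regroup : ∀ a′ r w a m q → a′ + r + w * a - m * a + q ≡ a′ + (r + ((w - m) * a + q))
    regroup = solve-∀

  Leads-prepend : ∀ {N ℓ es f} → Inc 1 es → Leads N ℓ es f → Leads N (suc ℓ) (0 ∷ es) (altSum (λ _ → f))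
  Leads-prepend {es = es} inc (leads _ len total {rest} spans splits) =
    leads (z≤n ∷ inc) (cong suc len) total (Span-prepend spans)
      λ xs → trans (altSum-cong xs λ _ ys _ → splits ys)
               (trans (altSum-+ (λ _ → alt es) (λ _ → rest) xs)
                      (cong (_+ altSum (λ _ → rest) xs) (alt-prepend es xs)))

  -- Signed sums over orderings

  rootProduct : List ℤ → ℤ → ℤ
  rootProduct [] s = 1ℤ
  rootProduct (m ∷ M) s = (s - m) * rootProduct M s

  -- For Ms = M_ℓ ∷ … ∷ M_1 and ℓ variables this is the sum over all orderings b_ℓ, …, b_1 of xs
  -- of their sign times the product of all b_1 + … + b_i - m with m ∈ M_i.
  orderSum : List (List ℤ) → List ℤ → ℤ
  orderSum [] xs = alt [] xs
  orderSum (M ∷ Ms) xs = rootProduct M (sumℤ xs) * altSum (λ _ → orderSum Ms) xs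

  Leads-rootProduct : ∀ {N ℓ es es′ f} M → Steps 0 (length M) es es′ → Leads N ℓ es f →
                      Leads (length M ℕ.+ N) ℓ es′ (λ xs → rootProduct M (sumℤ xs) * f xs)
  Leads-rootProduct {f = f} [] done (leads inc len total spans splits) =
    leads inc len total spans λ xs → trans (ℤ.*-identityˡ (f xs)) (splits xs)
  Leads-rootProduct {f = f} (m ∷ M) (steps ▸ step) L
    with leads inc len total spans splits ← Leads-mul m step (Leads-rootProduct M steps L) =
    leads inc len total spans
      λ xs → trans (ℤ.*-assoc (sumℤ xs - m) (rootProduct M (sumℤ xs)) (f xs)) (splits xs)

  Leads-orderSum : ∀ Ms {es} → Path (map length Ms) es →
                   Leads (sum (map length Ms)) (length Ms) es (orderSum Ms)
  Leads-orderSum [] start = leads [] refl refl zeroˢ λ xs → sym (ℤ.+-identityʳ (alt [] xs))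
  Leads-orderSum (M ∷ Ms) (round path inc steps) =
    Leads-rootProduct M steps (Leads-prepend inc (Leads-orderSum Ms path))

  -- In the minimal degree both the leading alternant and the rest are multiples of the alternant of
  -- `iota 0 (length Ms)`, with total coefficient 1 + t for a natural number t.
  orderSum-nonzero : ∀ Ms {es} → Path (map length Ms) es →
    sum (map length Ms) ≡ sum (iota 0 (length Ms)) →
    ∀ xs → alt (iota 0 (length Ms)) xs ≢ 0ℤ → orderSum Ms xs ≢ 0ℤ
  orderSum-nonzero Ms path degree xs alt≢0 eq with Leads-orderSum Ms path
  ... | leads inc len total spans splits
    with t , rest≗ ← Span-minimal (subst (λ N → Span N (length Ms) _) degree spans)
    with ℤ.i*j≡0⇒i≡0∨j≡0 (pos (suc t)) (trans (sym value) eq)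
    where
    value : orderSum Ms xs ≡ pos (suc t) * alt (iota 0 (length Ms)) xs
    value = trans (splits xs) (trans
      (cong₂ _+_ (cong (λ es → alt es xs)
                    (trans (Inc-minimal inc (ℕ.≤-reflexive (trans (trans total degree)
                             (cong (λ n → sum (iota 0 n)) (sym len)))))
                           (cong (iota 0) len)))
                 (rest≗ xs))
      (sym (ℤ.suc-* (pos t) (alt (iota 0 (length Ms)) xs))))
  ... | inj₁ ()
  ... | inj₂ alt≡0 = alt≢0 alt≡0

  rootProduct-root : ∀ {M s} → s ∈ M → rootProduct M s ≡ 0ℤ
  rootProduct-root {m ∷ M} (here refl) =
    trans (cong (_* rootProduct M m) (ℤ.+-inverseʳ m)) (ℤ.*-zeroˡ (rootProduct M m))
  rootProduct-root {m ∷ M} {s} (there s∈M) =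
    trans (cong ((s - m) *_) (rootProduct-root s∈M)) (ℤ.*-zeroʳ (s - m))

  -- A nonzero `rootProduct` keeps the sum of the current elements out of `M`; a nonzero alternating
  -- sum supplies an element to take out before recursing. The sums met on the way are those of
  -- suffixes.
  order-of-nonzero : ∀ {M} Ms xs → All (M ⊆_) Ms → length Ms ≡ length xs → orderSum Ms xs ≢ 0ℤ →
                     ∃ λ zs → zs ↭ xs × (∀ k → k < length xs → sumℤ (drop k zs) ∉ M)
  order-of-nonzero [] [] [] _ _ = [] , ↭-refl , λ _ ()
  order-of-nonzero {M} (M′ ∷ Ms) xs (M⊆M′ ∷ M⊆Ms) len s≢0 =
    let y , ys , y∷ys↭xs , ys≢0 = altSum-nonzero (λ _ → orderSum Ms) xs λ eq →
          s≢0 (trans (cong (rootProduct M′ (sumℤ xs) *_) eq) (ℤ.*-zeroʳ (rootProduct M′ (sumℤ xs))))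
        zs , zs↭ys , avoids = order-of-nonzero Ms ys M⊆Ms
          (ℕ.suc-injective (trans len (sym (↭-length y∷ys↭xs)))) ys≢0
        y∷zs↭xs = ↭-trans (prep y zs↭ys) y∷ys↭xs
        avoids′ : ∀ k → k < length xs → sumℤ (drop k (y ∷ zs)) ∉ M
        avoids′ = λ where
          zero _ s∈M → s≢0 (trans
            (cong (_* altSum (λ _ → orderSum Ms) xs)
                  (rootProduct-root (M⊆M′ (subst (_∈ M) (sumℤ-↭ y∷zs↭xs) s∈M))))
            (ℤ.*-zeroˡ (altSum (λ _ → orderSum Ms) xs)))
          (suc k) k<n → avoids k (ℕ.≤-pred (subst (suc k <_) (sym (↭-length y∷ys↭xs)) k<n))
    in y ∷ zs , y∷zs↭xs , avoids′

-- From a path to an ordering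

-- Supplies the nodes, which must be a total function. Any default would do, since
-- `alt-iota-nonzero` compares only nodes below the length.
nth : List ℤ → ℕ → ℤ
nth [] _ = 0ℤ
nth (x ∷ xs) zero = x
nth (x ∷ xs) (suc i) = nth xs i

map-iota-suc : ∀ (f : ℕ → ℤ) b ℓ → map f (iota (suc b) ℓ) ≡ map (f ∘ suc) (iota b ℓ)
map-iota-suc f b zero = refl
map-iota-suc f b (suc ℓ) = cong (f (suc b) ∷_) (map-iota-suc f (suc b) ℓ)

map-nth : ∀ xs → map (nth xs) (iota 0 (length xs)) ≡ xs
map-nth [] = refl
map-nth (x ∷ xs) = cong (x ∷_) (trans (map-iota-suc (nth (x ∷ xs)) 0 (length xs)) (map-nth xs))

All-nth : ∀ {P : ℤ → Set} {xs} → All P xs → ∀ i → i < length xs → P (nth xs i)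
All-nth (p ∷ ps) zero _ = p
All-nth (p ∷ ps) (suc i) (s≤s i<n) = All-nth ps i i<n

Unique-nth : ∀ {xs} → Unique xs → ∀ i j → i < j → j < length xs → nth xs i ≢ nth xs j
Unique-nth (x∉ ∷ _) zero (suc j) _ (s≤s j<n) = All-nth x∉ j j<n
Unique-nth (_ ∷ uniq) (suc i) (suc j) (s≤s i<j) (s≤s j<n) = Unique-nth uniq i j i<j j<n

sumℤ-++ : ∀ xs ys → sumℤ (xs ++ ys) ≡ sumℤ xs + sumℤ ys
sumℤ-++ [] ys = sym (ℤ.+-identityˡ (sumℤ ys))
sumℤ-++ (x ∷ xs) ys = trans (cong (λ s → x + s) (sumℤ-++ xs ys)) (sym (ℤ.+-assoc x (sumℤ xs) (sumℤ ys)))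

Ordering : List ℤ → List ℤ → Set
Ordering M xs = ∃ λ zs → zs ↭ xs × (∀ k → 1 ≤ k → k < length xs → sumℤ (take k zs) ∉ M)

-- The alternating sum controls the sums of suffixes, so it is used with the set sumℤ xs - M; its
-- factors are padded with arbitrary roots up to the degrees in ds.
path⇒ordering : ∀ {ds es} → Path ds es → Inc 1 es → sum ds ≡ sum (iota 0 (suc (length ds))) →
                ∀ xs → Unique xs → length xs ≡ suc (length ds) →
                ∀ M → All (length M ≤_) ds → Ordering M xs
path⇒ordering {ds} {es} path inc degree xs uniq len M M≤ds =
  let y , ys , y∷ys↭xs , ys≢0 = altSum-nonzero (λ _ → orderSum Ms) xs nonzero
      zs , zs↭ys , avoids = order-of-nonzero {M′} Ms ys (All.map⁺ (universal M′⊆pad ds))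
        (trans (length-map pad ds) (ℕ.suc-injective (trans (sym len) (sym (↭-length y∷ys↭xs))))) ys≢0
      y∷zs↭xs = ↭-trans (prep y zs↭ys) y∷ys↭xs
      avoids′ : ∀ k → 1 ≤ k → k < length xs → sumℤ (take k (y ∷ zs)) ∉ M
      avoids′ = λ where
        (suc k) _ k<n s∈M → avoids k (ℕ.≤-pred (subst (suc k <_) (sym (↭-length y∷ys↭xs)) k<n))
          (subst (_∈ M′) (complement (suc k) (y ∷ zs) y∷zs↭xs) (∈-map⁺ (λ m → sumℤ xs - m) s∈M))
  in y ∷ zs , y∷zs↭xs , avoids′
  where
  open Alternant (nth xs)
  M′ : List ℤ
  M′ = map (λ m → sumℤ xs - m) M
  pad : ℕ → List ℤ
  pad d = M′ ++ replicate (d ∸ length M′) 0ℤ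
  M′⊆pad : ∀ d → M′ ⊆ pad d
  M′⊆pad d = ∈-++⁺ˡ
  Ms : List (List ℤ)
  Ms = map pad ds
  length-pad : ∀ {d} → length M ≤ d → length (pad d) ≡ d
  length-pad {d} M≤d = trans (length-++ M′) (trans
    (cong (length M′ ℕ.+_) (length-replicate (d ∸ length M′)))
    (ℕ.m+[n∸m]≡n (subst (_≤ d) (sym (length-map _ M)) M≤d)))
  lengths-Ms : ∀ {ds} → All (length M ≤_) ds → map length (map pad ds) ≡ ds
  lengths-Ms [] = refl
  lengths-Ms (M≤d ∷ M≤ds) = cong₂ _∷_ (length-pad M≤d) (lengths-Ms M≤ds)
  -- The sum of all the numbers is unrestricted, so the last round has degree 0 and only prepends
  -- the exponent 0.
  path′ : Path (map length ([] ∷ Ms)) (0 ∷ es)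
  path′ = round (subst (λ ds → Path ds es) (sym (lengths-Ms M≤ds)) path) inc done
  length-Ms : suc (length Ms) ≡ length xs
  length-Ms = trans (cong suc (length-map pad ds)) (sym len)
  alt≢0 : alt (iota 0 (suc (length Ms))) xs ≢ 0ℤ
  alt≢0 = subst (λ n → alt (iota 0 n) xs ≢ 0ℤ) (sym length-Ms)
    (subst (λ ys → alt (iota 0 (length xs)) ys ≢ 0ℤ) (map-nth xs)
      (alt-iota-nonzero 0 (length xs) (Unique-nth uniq)))
  degree′ : sum (map length Ms) ≡ sum (iota 0 (suc (length Ms)))
  degree′ = trans (cong sum (lengths-Ms M≤ds))
    (trans degree (cong (λ n → sum (iota 0 (suc n))) (sym (length-map pad ds))))
  nonzero : altSum (λ _ → orderSum Ms) xs ≢ 0ℤ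
  nonzero eq = orderSum-nonzero ([] ∷ Ms) path′ degree′ xs alt≢0
    (trans (ℤ.*-identityˡ (altSum (λ _ → orderSum Ms) xs)) eq)
  cancel : ∀ p q → p + q - p ≡ q
  cancel = solve-∀
  complement : ∀ k zs → zs ↭ xs → sumℤ xs - sumℤ (take k zs) ≡ sumℤ (drop k zs)
  complement k zs zs↭xs = trans
    (cong (λ s → s - sumℤ (take k zs)) (trans (sym (sumℤ-↭ zs↭xs))
      (trans (cong sumℤ (sym (take++drop≡id k zs))) (sumℤ-++ (take k zs) (drop k zs)))))
    (cancel (sumℤ (take k zs)) (sumℤ (drop k zs)))

-- A path for the constant degree k

Steps-trans : ∀ {b d d′ es es′ es″} → Steps b d es es′ → Steps b d′ es′ es″ → Steps b (d′ ℕ.+ d) es es″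
Steps-trans p done = p
Steps-trans p (q ▸ s) = Steps-trans p q ▸ s

Steps-cons : ∀ {b d e es es′} → b ≤ e → Steps (suc e) d es es′ → Steps b d (e ∷ es) (e ∷ es′)
Steps-cons b≤e done = done
Steps-cons b≤e (p ▸ s) = Steps-cons b≤e p ▸ keep b≤e s

Step-weaken : ∀ {b b′ es es′} → b ≤ b′ → Step b′ es es′ → Step b es es′
Step-weaken b≤b′ (bump b′≤ inc) = bump (ℕ.≤-trans b≤b′ b′≤) inc
Step-weaken b≤b′ (keep b′≤ s) = keep (ℕ.≤-trans b≤b′ b′≤) s

Steps-weaken : ∀ {b b′ d es es′} → b ≤ b′ → Steps b′ d es es′ → Steps b d es es′
Steps-weaken b≤b′ done = done
Steps-weaken b≤b′ (p ▸ s) = Steps-weaken b≤b′ p ▸ Step-weaken b≤b′ s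

Steps-iota++ : ∀ {b b′ d es es′} r → b ≤ b′ → Steps (b′ ℕ.+ r) d es es′ →
               Steps b d (iota b′ r ++ es) (iota b′ r ++ es′)
Steps-iota++ {b′ = b′} zero b≤b′ p = Steps-weaken (ℕ.≤-trans b≤b′ (ℕ.m≤m+n b′ 0)) p
Steps-iota++ {b′ = b′} {d} {es} {es′} (suc r) b≤b′ p = Steps-cons b≤b′
  (Steps-iota++ r ℕ.≤-refl (subst (λ n → Steps n d es es′) (ℕ.+-suc b′ r) p))

-- The entries are raised from the last to the first, so that none meets its neighbour.
shift-iota : ∀ b ℓ {H} → Inc (suc b ℕ.+ ℓ) H → Steps b ℓ (iota b ℓ ++ H) (iota (suc b) ℓ ++ H)
shift-iota b zero inc = done
shift-iota b (suc ℓ) {H} inc = Steps-cons ℕ.≤-refl (shift-iota (suc b) ℓ inc′)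
    ▸ bump (ℕ.n≤1+n b) (Inc-iota++ (suc (suc b)) ℓ inc′)
  where
  inc′ : Inc (suc (suc b) ℕ.+ ℓ) H
  inc′ = subst (λ n → Inc n H) (cong suc (ℕ.+-suc b ℓ)) inc

raise : ∀ {b e} d {H} → b ≤ e → Inc (suc (d ℕ.+ e)) H → Steps b d (e ∷ H) (d ℕ.+ e ∷ H)
raise zero b≤e inc = done
raise {b} {e} (suc d) b≤e inc = raise d b≤e (Inc-weaken (ℕ.n≤1+n _) inc)
  ▸ bump (ℕ.m≤n⇒m≤1+n (ℕ.≤-trans b≤e (ℕ.m≤n+m e d))) inc

iota-snoc : ∀ b r H → iota b (suc r) ++ H ≡ iota b r ++ (b ℕ.+ r) ∷ H
iota-snoc b zero H = cong (_∷ H) (sym (ℕ.+-identityʳ b))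
iota-snoc b (suc r) H = cong (b ∷_) (trans (iota-snoc (suc b) r H)
  (cong (λ n → iota (suc b) r ++ n ∷ H) (sym (ℕ.+-suc b r))))

-- The first `suc r` steps shift 0, ..., r to 1, ..., r + 1; the other `j` raise the last of these
-- to `j + suc r`.
round-low : ∀ {ds} r j {H} → Inc (suc (j ℕ.+ suc r)) H → Path ds (iota 1 r ++ H) →
            Path (j ℕ.+ suc r ∷ ds) (iota 1 r ++ (j ℕ.+ suc r) ∷ H)
round-low r j {H} inc path = round path
  (Inc-iota++ 1 r (Inc-weaken (ℕ.m≤n⇒m≤1+n (ℕ.m≤n+m (suc r) j)) inc))
  (Steps-trans
    (subst (Steps 0 (suc r) (iota 0 (suc r) ++ H)) (iota-snoc 1 r H)
      (shift-iota 0 (suc r) (Inc-weaken (s≤s (ℕ.m≤n+m (suc r) j)) inc)))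
    (Steps-iota++ r z≤n (raise j ℕ.≤-refl inc)))

-- After the same shift the `j` spare steps raise the entry `k`, which in `constant-path` is the one
-- just placed by `round-low`.
round-high : ∀ {ds} r j {k H} → suc (suc r) ≤ k → Inc (suc (j ℕ.+ k)) H → Path ds (iota 1 r ++ k ∷ H) →
             Path (j ℕ.+ suc r ∷ ds) (iota 1 (suc r) ++ (j ℕ.+ k) ∷ H)
round-high r j {k} 2+r≤k inc path = round path
  (Inc-iota++ 1 r (ℕ.≤-trans (ℕ.n≤1+n _) 2+r≤k ∷ tail))
  (Steps-trans (shift-iota 0 (suc r) (2+r≤k ∷ tail)) (Steps-iota++ (suc r) z≤n (raise j 2+r≤k inc)))
  where
  tail = Inc-weaken (s≤s (ℕ.m≤n+m k j)) inc

replicate-snoc : ∀ (k n : ℕ) ds → replicate n k ++ k ∷ ds ≡ k ∷ replicate n k ++ ds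
replicate-snoc k zero ds = refl
replicate-snoc k (suc n) ds = cong (k ∷_) (replicate-snoc k n ds)

-- After 2r rounds the sequence consists of 1, …, r and of r entries that have already reached
-- their final positions 2k - r, …, 2k - 1.
constant-path : ∀ {ds} k j r {H} → k ≡ j ℕ.+ suc r → Inc (suc (j ℕ.+ k)) H → Path ds (iota 1 r ++ H) →
                ∃ λ es → Inc 1 es × Path (replicate (suc (j ℕ.+ j)) k ++ ds) es
-- One round is left. It has no spare steps: the shift alone puts 1, ..., k in front of `H`.
constant-path k zero r refl inc path =
  _ , Inc-iota++ 1 r (ℕ.≤-refl ∷ inc) , round-low r 0 inc path
constant-path {ds} k (suc j) r {H} refl inc path =
  let es , inc′ , path′ = constant-path k j (suc r) (sym (ℕ.+-suc j (suc r)))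
        (ℕ.≤-refl ∷ inc)
        (round-high r (suc j) (s≤s (ℕ.m≤n+m (suc r) j)) inc
          (round-low r (suc j) (Inc-weaken (s≤s (ℕ.m≤n+m k (suc j))) inc) path))
  in es , inc′ , subst (λ ds → Path ds es) degrees path′
  where
  degrees : replicate (suc (j ℕ.+ j)) k ++ k ∷ k ∷ ds ≡ replicate (suc (suc j ℕ.+ suc j)) k ++ ds
  degrees = trans (replicate-snoc k (suc (j ℕ.+ j)) (k ∷ ds))
    (trans (cong (k ∷_) (replicate-snoc k (suc (j ℕ.+ j)) ds))
      (cong (λ n → replicate (suc (suc n)) k ++ ds) (sym (ℕ.+-suc j j))))

-- Degree count and the two parities

-- The arithmetic series, doubled and with `ℓ` moved across to avoid division and truncated
-- subtraction.
sum-iota : ∀ b ℓ → 2 ℕ.* sum (iota b ℓ) ℕ.+ ℓ ≡ ℓ ℕ.* (2 ℕ.* b ℕ.+ ℓ)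
sum-iota b zero = refl
sum-iota b (suc ℓ) = trans (split b (sum (iota (suc b) ℓ)) ℓ)
  (trans (cong (2 ℕ.* b ℕ.+ 1 ℕ.+_) (sum-iota (suc b) ℓ)) (collect b ℓ))
  where
  split : ∀ b s ℓ → 2 ℕ.* (b ℕ.+ s) ℕ.+ suc ℓ ≡ 2 ℕ.* b ℕ.+ 1 ℕ.+ (2 ℕ.* s ℕ.+ ℓ)
  split = NatSolver.solve-∀
  collect : ∀ b ℓ → 2 ℕ.* b ℕ.+ 1 ℕ.+ ℓ ℕ.* (2 ℕ.* suc b ℕ.+ ℓ) ≡ suc ℓ ℕ.* (2 ℕ.* b ℕ.+ suc ℓ)
  collect = NatSolver.solve-∀

sum≡sum-iota : ∀ {s} n → 2 ℕ.* s ℕ.+ n ≡ n ℕ.* n → s ≡ sum (iota 0 n)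
sum≡sum-iota n eq = ℕ.*-cancelˡ-≡ _ _ 2 (ℕ.+-cancelʳ-≡ n _ _ (trans eq (sym (sum-iota 0 n))))

sum-replicate : ∀ n (k : ℕ) → sum (replicate n k) ≡ n ℕ.* k
sum-replicate zero k = refl
sum-replicate (suc n) k = cong (k ℕ.+_) (sum-replicate n k)

-- With k = j + 1 and n = 2k, the 2k - 1 rounds of degree k have total degree (2k - 1)k = n(n -
-- 1)/2, as required.
even-ordering : ∀ j xs → Unique xs → length xs ≡ suc j ℕ.+ suc j → ∀ M → length M ≤ suc j → Ordering M xs
even-ordering j xs uniq len M M≤ =
  let es , inc , path = constant-path (suc j) j 0 (sym (ℕ.+-comm j 1)) [] start
  in path⇒ordering path inc degree xs uniq
       (trans len (cong suc (trans (ℕ.+-suc j j) (sym length-ds)))) M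
       (All.++⁺ (All.replicate⁺ (suc (j ℕ.+ j)) M≤) [])
  where
  ds : List ℕ
  ds = replicate (suc (j ℕ.+ j)) (suc j) ++ []
  length-ds : length ds ≡ suc (j ℕ.+ j)
  length-ds = trans (cong length (++-identityʳ (replicate (suc (j ℕ.+ j)) (suc j)))) (length-replicate (suc (j ℕ.+ j)))
  arithmetic : ∀ j → 2 ℕ.* (suc (j ℕ.+ j) ℕ.* suc j) ℕ.+ suc (suc (j ℕ.+ j)) ≡ suc (suc (j ℕ.+ j)) ℕ.* suc (suc (j ℕ.+ j))
  arithmetic = NatSolver.solve-∀
  degree : sum ds ≡ sum (iota 0 (suc (length ds)))
  degree = trans (cong sum (++-identityʳ (replicate (suc (j ℕ.+ j)) (suc j))))
    (trans (sum-replicate (suc (j ℕ.+ j)) (suc j))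
    (trans (sum≡sum-iota (suc (suc (j ℕ.+ j))) (arithmetic j))
           (cong (λ n → sum (iota 0 (suc n))) (sym length-ds))))

-- With one variable more than in the even case, the first round of degree 2k moves its entry to
-- the final position 2k at once.
odd-ordering : ∀ j xs → Unique xs → length xs ≡ suc (suc j ℕ.+ suc j) → ∀ M → length M ≤ suc j → Ordering M xs
odd-ordering j xs uniq len M M≤ =
  let es , inc , path = constant-path (suc j) j 0 (sym (ℕ.+-comm j 1)) (ℕ.≤-refl ∷ [])
        (round start [] (subst (λ n → Steps 0 d (0 ∷ []) (n ∷ [])) (ℕ.+-identityʳ d) (raise d z≤n [])))
  in path⇒ordering path inc degree xs uniq (trans len (cong suc (sym length-ds))) M
       (All.++⁺ (All.replicate⁺ (suc (j ℕ.+ j)) M≤) (ℕ.≤-trans M≤ (ℕ.m≤m+n (suc j) (suc j)) ∷ []))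
  where
  d : ℕ
  d = suc j ℕ.+ suc j
  ds : List ℕ
  ds = replicate (suc (j ℕ.+ j)) (suc j) ++ d ∷ []
  length-ds : length ds ≡ d
  length-ds = trans (length-++ (replicate (suc (j ℕ.+ j)) (suc j)))
    (trans (cong (ℕ._+ 1) (length-replicate (suc (j ℕ.+ j)))) (arith j))
    where
    arith : ∀ j → suc (j ℕ.+ j) ℕ.+ 1 ≡ suc j ℕ.+ suc j
    arith = NatSolver.solve-∀
  -- With k = j + 1 the total degree is (2k - 1)k + 2k = k(2k + 1), which is n(n - 1)/2 for n = 2k +
  -- 1.
  arithmetic : ∀ j → 2 ℕ.* (suc (j ℕ.+ j) ℕ.* suc j ℕ.+ (suc j ℕ.+ suc j ℕ.+ 0)) ℕ.+ suc (suc j ℕ.+ suc j)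
                     ≡ suc (suc j ℕ.+ suc j) ℕ.* suc (suc j ℕ.+ suc j)
  arithmetic = NatSolver.solve-∀
  degree : sum ds ≡ sum (iota 0 (suc (length ds)))
  degree = trans (sum-++ (replicate (suc (j ℕ.+ j)) (suc j)) (d ∷ []))
    (trans (cong (ℕ._+ (d ℕ.+ 0)) (sum-replicate (suc (j ℕ.+ j)) (suc j)))
    (trans (sum≡sum-iota (suc d) (arithmetic j))
           (cong (λ n → sum (iota 0 (suc n))) (sym length-ds))))

-- Deleting an adjoined zero

take-insert-zero : ∀ ps qs k → ∃ λ k′ → k ≤ k′ × k′ ≤ suc k ×
                   sumℤ (take k′ (ps ++ 0ℤ ∷ qs)) ≡ sumℤ (take k (ps ++ qs))
take-insert-zero [] qs k = suc k , ℕ.n≤1+n k , ℕ.≤-refl , ℤ.+-identityˡ (sumℤ (take k qs))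
take-insert-zero (p ∷ ps) qs zero = zero , z≤n , z≤n , refl
take-insert-zero (p ∷ ps) qs (suc k) =
  let k′ , k≤k′ , k′≤1+k , eq = take-insert-zero ps qs k
  in suc k′ , s≤s k≤k′ , s≤s k′≤1+k , cong (λ s → p + s) eq

-- Each prefix sum after the deletion is a prefix sum before it, at the same position or the next;
-- the longer ordering is controlled at one more position.
remove-zero : ∀ {M xs} → Ordering M (0ℤ ∷ xs) → Ordering M xs
remove-zero {M} {xs} (zs , zs↭0∷xs , avoids) with ∈-∃++ (∈-resp-↭ (↭-sym zs↭0∷xs) (here refl))
... | ps , qs , refl = ps ++ qs , drop-mid ps [] zs↭0∷xs , λ k 1≤k k<n s∈M →
  let k′ , k≤k′ , k′≤1+k , eq = take-insert-zero ps qs k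
  in avoids k′ (ℕ.≤-trans 1≤k k≤k′) (s≤s (ℕ.≤-trans k′≤1+k k<n)) (subst (_∈ M) (sym eq) s∈M)

-- From orderings of lists to permutations

prefixSum-take : ∀ {n} (b : Fin n → ℤ) zs .(eq : n ≡ length zs) → (∀ i → b i ≡ lookup zs (cast eq i)) →
                 ∀ k → prefixSum b k ≡ sumℤ (take k zs)
prefixSum-take {zero} b [] eq b≗ zero = refl
prefixSum-take {zero} b [] eq b≗ (suc k) = refl
prefixSum-take {suc n} b (z ∷ zs) eq b≗ zero = refl
prefixSum-take {suc n} b (z ∷ zs) eq b≗ (suc k) =
  cong₂ _+_ (b≗ zero) (prefixSum-take (b ∘ suc) zs (ℕ.suc-injective eq) (b≗ ∘ suc) k)

ordering⇒permutation : ∀ {n} (a : Fin n → ℤ) M → Ordering M (tabulate a) →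
  ∃ λ (σ : Permutation′ n) → (k : ℕ) → 1 ≤ k → k < n → prefixSum (λ i → a (σ ⟨$⟩ʳ i)) k ∉ M
ordering⇒permutation {n} a M (zs , zs↭a , avoids) =
  σ , λ k 1≤k k<n s∈M → avoids k 1≤k (subst (k <_) (sym (length-tabulate a)) k<n)
        (subst (_∈ M) (prefixSum-take (λ i → a (σ ⟨$⟩ʳ i)) zs n≡ values k) s∈M)
  where
  n≡ : n ≡ length zs
  n≡ = sym (trans (↭-length zs↭a) (length-tabulate a))
  zs↭ₛa = ↭⇒↭ₛ zs↭a
  σ : Permutation′ n
  -- A position in `zs` is sent to the index in `a` of the element standing there; the casts
  -- identify `Fin n` with the index types of the two lists.
  σ = cast-id n≡ ∘ₚ (onIndices zs↭ₛa ∘ₚ cast-id (length-tabulate a))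
  lookup-cast : ∀ i → a (cast (length-tabulate a) i) ≡ lookup (tabulate a) i
  lookup-cast i = trans (sym (lookup-tabulate a _))
    (cong (lookup (tabulate a)) (cast-involutive (sym (length-tabulate a)) (length-tabulate a) i))
  values : ∀ i → a (σ ⟨$⟩ʳ i) ≡ lookup zs (cast n≡ i)
  values i = trans (lookup-cast _) (sym (onIndices-lookup zs↭ₛa (cast n≡ i)))

-- Halves and the case distinction on parity

parity : ∀ n → ∃ λ j → n ≡ j ℕ.+ j ⊎ n ≡ suc (j ℕ.+ j)
parity zero = 0 , inj₁ refl
parity (suc n) with parity n
... | j , inj₁ refl = j , inj₂ refl
... | j , inj₂ refl = suc j , inj₁ (cong suc (sym (ℕ.+-suc j j)))

half-even : ∀ j → (j ℕ.+ j) / 2 ≡ j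
half-even j = trans (cong (_/ 2) (double j)) (m*n/n≡m j 2)
  where
  double : ∀ j → j ℕ.+ j ≡ j ℕ.* 2
  double = NatSolver.solve-∀

half-odd : ∀ j → suc (j ℕ.+ j) / 2 ≡ j
half-odd zero = refl
half-odd (suc j) = trans (cong (λ n → suc (suc n) / 2) (ℕ.+-suc j j))
  (trans (m/n≡1+[m∸n]/n {suc (suc (suc (j ℕ.+ j)))} {2} (s≤s (s≤s z≤n))) (cong suc (half-odd j)))

theorem1 : (n : ℕ) → 1 ≤ n → (a : Fin n → ℤ) → Injective _≡_ _≡_ a →
    ((M : List ℤ) → Unique M → length M ≤ n / 2 →
    ∃ λ (σ : Permutation′ n) →
    (k : ℕ) → 1 ≤ k → k < n → prefixSum (λ i → a (σ ⟨$⟩ʳ i)) k ∉ M)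
    × (((i : Fin n) → a i ≢ 0ℤ) → (M : List ℤ) → Unique M → length M ≤ suc n / 2 →
    ∃ λ (σ : Permutation′ n) →
    (k : ℕ) → 1 ≤ k → k < n → prefixSum (λ i → a (σ ⟨$⟩ʳ i)) k ∉ M)
theorem1 n 1≤n a inj with parity n
theorem1 _ () a inj | zero , inj₁ refl
theorem1 n 1≤n a inj | suc j , inj₁ refl =
  (λ M _ M≤ → permute M (subst (length M ≤_) (half-even (suc j)) M≤)) ,
  -- For even `n` both bounds equal n/2, so both claims are the even case.
  (λ _ M _ M≤ → permute M (subst (length M ≤_) (half-odd (suc j)) M≤))
  where
  permute = λ M M≤ → ordering⇒permutation a M
    (even-ordering j (tabulate a) (tabulate⁺ inj) (length-tabulate a) M M≤)
theorem1 n 1≤n a inj | j , inj₂ refl =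
  (λ M _ M≤ → permute j a inj M (subst (length M ≤_) (half-odd j) M≤)) ,
  (λ a≢0 M _ M≤ → ordering⇒permutation a M (remove-zero
    -- Since no `a i` is 0, adjoining 0 gives 2(j + 1) distinct integers, for which `M` may have j +
    -- 1 elements.
    (even-ordering j (0ℤ ∷ tabulate a)
      (All.tabulate⁺ (λ i 0≡ai → a≢0 i (sym 0≡ai)) ∷ tabulate⁺ inj)
      (cong suc (trans (length-tabulate a) (sym (ℕ.+-suc j j)))) M
      (subst (length M ≤_) (trans (cong (λ m → suc m / 2) (sym (ℕ.+-suc j j))) (half-even (suc j))) M≤))))
  where
  permute : ∀ j (a : Fin (suc (j ℕ.+ j)) → ℤ) → Injective _≡_ _≡_ a → ∀ M → length M ≤ j →
    ∃ λ (σ : Permutation′ (suc (j ℕ.+ j))) →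
    (k : ℕ) → 1 ≤ k → k < suc (j ℕ.+ j) → prefixSum (λ i → a (σ ⟨$⟩ʳ i)) k ∉ M
  permute zero a inj M _ = id , λ { (suc _) _ (s≤s ()) }
  permute (suc j) a inj M M≤ = ordering⇒permutation a M
    (odd-ordering j (tabulate a) (tabulate⁺ inj) (length-tabulate a) M M≤)
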